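{- For every integer $g\ge 0$, let $S^g=\big((a^g_n,b^g_n)\big)_{n\ge 0}$ be the $g$-sequence of 2-Star Nim. Then the sequence $(b^g_n-a^g_n)_{n\ge 0}$ is ultimately periodic.
   Context: 2-Star Nim: a position is a pair $(a,b)$ of nonnegative integers, not both $0$ (one token on square $a$ of a first strip and one on square $b$ of a second strip, the two strips sharing their square $0$, which holds at most one token). A move replaces exactly one coordinate by a smaller nonnegative integer, provided the result is not $(0,0)$. A player unable to move loses. $\mathcal{G}(a,b)$ is the Sprague-Grundy value, $\mathcal{G}(p)=\operatorname{mex}\{\mathcal{G}(q): q\text{ reachable from }p\text{ in one move}\}$, where $\operatorname{mex}(S)$ is the least nonnegative integer not in $S$. It is symmetric in $a,b$. The $g$-sequence $S^g=\big((a^g_0,b^g_0),(a^g_1,b^g_1),\ldots\big)$ lists all positions $(a,b)$ with $a\le b$ and $\mathcal{G}(a,b)=g$, ordered so that $a^g_i<a^g_j$ whenever $i<j$ (it is an infinite sequence). A sequence $(s_n)_{n\ge0}$ is ultimately periodic if there exist $n_0\ge 0$ and $p\ge1$ such that $s_{n+p}=s_n$ for all $n\ge n_0$. -}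

module Defs where

open import Data.Empty.Irrelevant using () renaming (⊥-elim to ⊥-elim-irr)
open import Data.Fin.Base using (Fin; toℕ; fromℕ<)
open import Data.Fin.Properties using (toℕ<n; toℕ-fromℕ<; any?; pigeonhole)
open import Data.List.Base using (List; _++_; map; mapMaybe; allFin)
open import Data.List.Extrema.Nat using (max; xs≤max)
open import Data.List.Membership.DecPropositional using () renaming (_∈?_ to mem?)
open import Data.List.Membership.Propositional using (_∈_; _∉_; lose)
open import Data.List.Membership.Propositional.Properties using (∈-map⁻; ∈-allFin)
open import Data.List.Properties using (map-cong)
open import Data.List.Relation.Unary.All as All using ()
open import Data.List.Relation.Unary.Any as Any using (Any)
open import Data.List.Relation.Unary.Any.Properties using (mapMaybe⁺; map⁺; ++⁺ˡ; ++⁺ʳ)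
open import Data.Maybe.Base using (Maybe; just; nothing)
import Data.Maybe.Relation.Unary.Any as MAny
open import Data.Nat.Base
open import Data.Nat.Induction using (<-wellFounded)
open import Data.Nat.Properties
open import Data.Product.Base using (∃; ∃-syntax; _×_; _,_; proj₁; proj₂)
open import Data.Sum.Base using (_⊎_; inj₁; inj₂)
open import Function.Base using (_∘_)
open import Induction.WellFounded using (Acc; acc; WellFounded; module Subrelation)
open import Relation.Binary.Construct.On as On using ()
open import Relation.Binary.Definitions using (tri<; tri≈; tri>)
open import Relation.Binary.PropositionalEquality
open import Relation.Nullary.Decidable using (Dec; yes; no; ¬?; _×-dec_)
open import Relation.Nullary.Negation using (¬_; contradiction)

-- The last field is irrelevant so that positions with equal coordinates
-- are definitionally equal.
record Position : Set where
  constructor pos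
  field
    left right : ℕ
    .not-both-0 : ¬ (left ≡ 0 × right ≡ 0)

open Position public using (left; right)

data _⟶_ : Position → Position → Set where
  moveˡ : ∀ {a a′ b} .{v : ¬ (a ≡ 0 × b ≡ 0)} .{v′ : ¬ (a′ ≡ 0 × b ≡ 0)} →
          a′ < a → pos a b v ⟶ pos a′ b v′
  moveʳ : ∀ {a b b′} .{v : ¬ (a ≡ 0 × b ≡ 0)} .{v′ : ¬ (a ≡ 0 × b′ ≡ 0)} →
          b′ < b → pos a b v ⟶ pos a b′ v′

position? : ∀ a b → Dec (¬ (a ≡ 0 × b ≡ 0))
position? a b = ¬? ((a ≟ 0) ×-dec (b ≟ 0))

moveˡ? : ∀ p → Fin (left p) → Maybe (∃ (p ⟶_))
moveˡ? (pos a b v) i with position? (toℕ i) b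
... | yes v′ = just (pos (toℕ i) b v′ , moveˡ (toℕ<n i))
... | no  _  = nothing

moveʳ? : ∀ p → Fin (right p) → Maybe (∃ (p ⟶_))
moveʳ? (pos a b v) i with position? a (toℕ i)
... | yes v′ = just (pos a (toℕ i) v′ , moveʳ (toℕ<n i))
... | no  _  = nothing

options : ∀ p → List (∃ (p ⟶_))
options p = mapMaybe (moveˡ? p) (allFin (left p))
         ++ mapMaybe (moveʳ? p) (allFin (right p))

⟶-wellFounded : WellFounded (λ q p → p ⟶ q)
⟶-wellFounded = Subrelation.wellFounded decreases
                  (On.wellFounded (λ p → left p + right p) <-wellFounded)
  where
  decreases : ∀ {q p} → p ⟶ q → left q + right q < left p + right p
  decreases (moveˡ {b = b} a′<a) = +-monoˡ-< b a′<a
  decreases (moveʳ {a = a} b′<b) = +-monoʳ-< a b′<b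

IsMex : (ℕ → Set) → ℕ → Set
IsMex P n = ¬ P n × (∀ {m} → m < n → P m)

-- Searches upwards from n, with k as fuel.
mexFrom : (k n : ℕ) → List ℕ → ℕ
mexFrom zero    n xs = n
mexFrom (suc k) n xs with mem? _≟_ n xs
... | yes _ = mexFrom k (suc n) xs
... | no  _ = n

mex : List ℕ → ℕ
mex xs = mexFrom (suc (max 0 xs)) 0 xs

𝒢-acc : ∀ p → Acc (λ q p → p ⟶ q) p → ℕ
𝒢-acc p (acc rs) = mex (map (λ (q , p⟶q) → 𝒢-acc q (rs p⟶q)) (options p))

-- Opaque only to keep type checking fast: 𝒢-isMex below is the defining
-- equation of the Sprague-Grundy function.
opaque
  𝒢 : Position → ℕ
  𝒢 p = 𝒢-acc p (⟶-wellFounded p)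

record IsGSequence (g : ℕ) (s : ℕ → Position) : Set where
  field
    ordered    : ∀ n → left (s n) ≤ right (s n)
    value      : ∀ n → 𝒢 (s n) ≡ g
    complete   : ∀ p → left p ≤ right p → 𝒢 p ≡ g → ∃[ n ] s n ≡ p
    increasing : ∀ {i j} → i < j → left (s i) < left (s j)

UltimatelyPeriodic : {A : Set} → (ℕ → A) → Set
UltimatelyPeriodic s =
  ∃[ n₀ ] ∃[ p ] 1 ≤ p × (∀ n → n₀ ≤ n → s (n + p) ≡ s n)

mexFrom-∉ : ∀ k n xs → (∀ {v} → v ∈ xs → v < n + k) → mexFrom k n xs ∉ xs
mexFrom-∉ zero    n xs bound n∈xs = <-irrefl (sym (+-identityʳ n)) (bound n∈xs)
mexFrom-∉ (suc k) n xs bound with mem? _≟_ n xs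
... | yes _    = mexFrom-∉ k (suc n) xs
                   (λ {v} v∈xs → subst (v <_) (+-suc n k) (bound v∈xs))
... | no  n∉xs = n∉xs

<mexFrom⇒∈ : ∀ k n xs → (∀ {v} → v < n → v ∈ xs) →
             ∀ {v} → v < mexFrom k n xs → v ∈ xs
<mexFrom⇒∈ zero    n xs below = below
<mexFrom⇒∈ (suc k) n xs below with mem? _≟_ n xs
... | no  _    = below
... | yes n∈xs = <mexFrom⇒∈ k (suc n) xs below′
  where
  below′ : ∀ {v} → v < suc n → v ∈ xs
  below′ v<1+n with m<1+n⇒m<n∨m≡n v<1+n
  ... | inj₁ v<n  = below v<n
  ... | inj₂ refl = n∈xs

mex-isMex : ∀ xs → IsMex (_∈ xs) (mex xs)
mex-isMex xs = mexFrom-∉ _ 0 xs (λ v∈xs → s≤s (All.lookup (xs≤max 0 xs) v∈xs))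
             , <mexFrom⇒∈ (suc (max 0 xs)) 0 xs (λ ())

IsMex-unique : ∀ {P Q : ℕ → Set} {m n} → (∀ {v} → P v → Q v) → (∀ {v} → Q v → P v) →
               IsMex P m → IsMex Q n → m ≡ n
IsMex-unique {m = m} {n} P⊆Q Q⊆P (¬Pm , <m⇒P) (¬Qn , <n⇒Q) with <-cmp m n
... | tri< m<n _ _ = contradiction (Q⊆P (<n⇒Q m<n)) ¬Pm
... | tri≈ _ m≡n _ = m≡n
... | tri> _ _ n<m = contradiction (P⊆Q (<m⇒P n<m)) ¬Qn

𝒢-acc-irrelevant : ∀ p (x y : Acc (λ q p → p ⟶ q) p) → 𝒢-acc p x ≡ 𝒢-acc p y
𝒢-acc-irrelevant p (acc rs) (acc rs′) =
  cong mex (map-cong (λ (q , m) → 𝒢-acc-irrelevant q (rs m) (rs′ m)) (options p))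

opaque
  unfolding 𝒢

  𝒢-unfold : ∀ p → 𝒢 p ≡ mex (map (𝒢 ∘ proj₁) (options p))
  𝒢-unfold p = go (⟶-wellFounded p)
    where
    go : (x : Acc (λ q p → p ⟶ q) p) → 𝒢-acc p x ≡ mex (map (𝒢 ∘ proj₁) (options p))
    go (acc rs) = cong mex (map-cong
      (λ (q , m) → 𝒢-acc-irrelevant q (rs m) (⟶-wellFounded q)) (options p))

options-complete : ∀ {p q} → p ⟶ q → Any (λ o → proj₁ o ≡ q) (options p)
options-complete (moveˡ {a} {a′} {b} {v} {v′} a′<a) =
  ++⁺ˡ (mapMaybe⁺ (moveˡ? (pos a b v)) (allFin a)
    (map⁺ (lose (∈-allFin (fromℕ< a′<a)) (found _ (toℕ-fromℕ< a′<a)))))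
  where
  found : ∀ i → toℕ i ≡ a′ → MAny.Any (λ o → proj₁ o ≡ pos a′ b v′) (moveˡ? (pos a b v) i)
  found i refl with position? (toℕ i) b
  ... | yes _  = MAny.just refl
  ... | no  ¬v = ⊥-elim-irr (¬v v′)
options-complete (moveʳ {a} {b} {b′} {v} {v′} b′<b) =
  ++⁺ʳ (mapMaybe (moveˡ? (pos a b v)) (allFin a))
    (mapMaybe⁺ (moveʳ? (pos a b v)) (allFin b)
      (map⁺ (lose (∈-allFin (fromℕ< b′<b)) (found _ (toℕ-fromℕ< b′<b)))))
  where
  found : ∀ i → toℕ i ≡ b′ → MAny.Any (λ o → proj₁ o ≡ pos a b′ v′) (moveʳ? (pos a b v) i)
  found i refl with position? a (toℕ i)
  ... | yes _  = MAny.just refl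
  ... | no  ¬v = ⊥-elim-irr (¬v v′)

𝒢-isMex : ∀ p → IsMex (λ v → ∃[ q ] p ⟶ q × 𝒢 q ≡ v) (𝒢 p)
𝒢-isMex p = subst (IsMex (λ v → ∃[ q ] p ⟶ q × 𝒢 q ≡ v)) (sym (𝒢-unfold p))
  (proj₁ (mex-isMex values) ∘ to , from ∘ proj₂ (mex-isMex values))
  where
  values = map (𝒢 ∘ proj₁) (options p)
  to : ∀ {v} → (∃[ q ] p ⟶ q × 𝒢 q ≡ v) → v ∈ values
  to (q , p⟶q , refl) = map⁺ (Any.map (λ { refl → refl }) (options-complete p⟶q))
  from : ∀ {v} → v ∈ values → ∃[ q ] p ⟶ q × 𝒢 q ≡ v
  from v∈ with ∈-map⁻ (𝒢 ∘ proj₁) v∈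
  ... | (q , p⟶q) , _ , v≡ = q , p⟶q , sym v≡

option-≢ : ∀ {p q} → p ⟶ q → 𝒢 q ≢ 𝒢 p
option-≢ {p} {q} p⟶q eq = proj₁ (𝒢-isMex p) (q , p⟶q , eq)

option-below : ∀ p {v} → v < 𝒢 p → ∃[ q ] p ⟶ q × 𝒢 q ≡ v
option-below p = proj₂ (𝒢-isMex p)

swap : Position → Position
swap (pos a b v) = pos b a (λ (b≡0 , a≡0) → v (a≡0 , b≡0))

swap-⟶ : ∀ {p q} → p ⟶ q → swap p ⟶ swap q
swap-⟶ (moveˡ lt) = moveʳ lt
swap-⟶ (moveʳ lt) = moveˡ lt

𝒢-swap : ∀ p → 𝒢 (swap p) ≡ 𝒢 p
𝒢-swap p = go p (⟶-wellFounded p)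
  where
  go : ∀ p → Acc (λ q p → p ⟶ q) p → 𝒢 (swap p) ≡ 𝒢 p
  go p (acc rs) = IsMex-unique
    (λ (q , m , eq) → swap q , swap-⟶ m , trans (sym (go (swap q) (rs (swap-⟶ m)))) eq)
    (λ (q , m , eq) → swap q , swap-⟶ m , trans (go q (rs m)) eq)
    (𝒢-isMex (swap p)) (𝒢-isMex p)

row-injective : ∀ p q → left p ≡ left q → 𝒢 p ≡ 𝒢 q → p ≡ q
row-injective (pos a b v) (pos a b′ v′) refl eq with <-cmp b b′
... | tri< b<b′ _ _  = contradiction eq (option-≢ (moveʳ b<b′))
... | tri≈ _ refl _  = refl
... | tri> _ _ b′<b  = contradiction (sym eq) (option-≢ (moveʳ b′<b))

column-injective : ∀ p q → right p ≡ right q → 𝒢 p ≡ 𝒢 q → p ≡ q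
column-injective p q r eq =
  cong swap (row-injective (swap p) (swap q) r
    (trans (𝒢-swap p) (trans eq (sym (𝒢-swap q)))))

HasValue : (g a b : ℕ) → Set
HasValue g a b = ∃[ p ] left p ≡ a × right p ≡ b × 𝒢 p ≡ g

hasValue? : ∀ g a b → Dec (HasValue g a b)
hasValue? g a b with position? a b
... | no ¬v = no λ { (pos _ _ v , refl , refl , _) → ⊥-elim-irr (¬v v) }
... | yes v with 𝒢 (pos a b v) ≟ g
...   | yes eq = yes (pos a b v , refl , refl , eq)
...   | no  ne = no λ { (pos _ _ _ , refl , refl , eq) → ne eq }

-- The reasons why the cell in row a and column b may fail to have value g
-- when no earlier cell of the row has value g.
data Blocked (g a b : ℕ) : Set where
  hole  : a ≡ 0 → b ≡ 0 → Blocked g a b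
  small : ∀ p → left p ≡ a → right p ≡ b → 𝒢 p < g → Blocked g a b
  above : ∀ q → left q < a → right q ≡ b → 𝒢 q ≡ g → Blocked g a b

code : ∀ {g a b} → Blocked g a b → ℕ
code     (hole  _ _)     = 0
code     (small p _ _ _) = suc (𝒢 p)
code {g} (above q _ _ _) = suc (g + left q)

code< : ∀ {g a b} (x : Blocked g a b) → code x < suc (suc (g + a))
code< {g} {a} (hole _ _)       = z<s
code< {g} {a} (small p _ _ lt) = s<s (m<n⇒m<1+n (≤-trans lt (m≤m+n g a)))
code< {g}     (above q lt _ _) = s<s (m<n⇒m<1+n (+-monoʳ-< g lt))

code-injective : ∀ {g a b b′} (x : Blocked g a b) (y : Blocked g a b′) →
                 code x ≡ code y → b ≡ b′
code-injective (hole _ refl) (hole _ refl) _ = refl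
code-injective (small p refl refl _) (small q l refl _) eq =
  cong right (row-injective p q (sym l) (suc-injective eq))
code-injective {g} (small p _ _ lt) (above q _ _ _) eq =
  contradiction (subst (_< g) (suc-injective eq) lt) (m+n≮m g (left q))
code-injective {g} (above q _ _ _) (small p _ _ lt) eq =
  contradiction (subst (_< g) (suc-injective (sym eq)) lt) (m+n≮m g (left q))
code-injective {g} (above p _ refl pg) (above q _ refl qg) eq =
  cong right (row-injective p q (+-cancelˡ-≡ g _ _ (suc-injective eq)) (trans pg (sym qg)))

blocked : ∀ g a b → (∀ {b′} → b′ ≤ b → ¬ HasValue g a b′) → Blocked g a b
blocked g a b none with a ≟ 0 ×-dec b ≟ 0
... | yes (a≡0 , b≡0) = hole a≡0 b≡0
... | no v with <-cmp (𝒢 (pos a b v)) g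
...   | tri< lt _ _ = small (pos a b v) refl refl lt
...   | tri≈ _ eq _ = contradiction (pos a b v , refl , refl , eq) (none ≤-refl)
...   | tri> _ _ gt with option-below (pos a b v) gt
...     | q , moveˡ a′<a , eq = above q a′<a refl eq
...     | q , moveʳ b′<b , eq = contradiction (q , refl , refl , eq) (none (<⇒≤ b′<b))

mate : ∀ g a → ∃[ p ] left p ≡ a × 𝒢 p ≡ g
mate g a with any? {n = 3 + (g + a)} (λ i → hasValue? g a (toℕ i))
... | yes (_ , p , l , _ , eq) = p , l , eq
... | no none = contradiction (code-injective (bl i) (bl j) code≡) (<⇒≢ i<j)
  where
  bl : (i : Fin (3 + (g + a))) → Blocked g a (toℕ i)
  bl i = blocked g a (toℕ i) λ {b′} b′≤i h →
    let b′<N = ≤-<-trans b′≤i (toℕ<n i) in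
    none (fromℕ< b′<N , subst (HasValue g a) (sym (toℕ-fromℕ< b′<N)) h)
  collision = pigeonhole (n<1+n _) (λ i → fromℕ< (code< (bl i)))
  i = proj₁ collision
  j = proj₁ (proj₂ collision)
  i<j = proj₁ (proj₂ (proj₂ collision))
  code≡ : code (bl i) ≡ code (bl j)
  code≡ = trans (sym (toℕ-fromℕ< (code< (bl i))))
            (trans (cong toℕ (proj₂ (proj₂ (proj₂ collision))))
              (toℕ-fromℕ< (code< (bl j))))

opaque
  partner : ℕ → ℕ → Position
  partner g a = proj₁ (mate g a)

  left-partner : ∀ g a → left (partner g a) ≡ a
  left-partner g a = proj₁ (proj₂ (mate g a))

  𝒢-partner : ∀ g a → 𝒢 (partner g a) ≡ g
  𝒢-partner g a = proj₂ (proj₂ (mate g a))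

mates-unbounded : ∀ g m → ∃[ p ] m ≤ left p × left p ≤ right p × 𝒢 p ≡ g
mates-unbounded g m with any? {n = suc m} (λ i → m ≤? right (partner g (m + toℕ i)))
... | yes (i , m≤r) with ≤-total (left (partner g (m + toℕ i))) (right (partner g (m + toℕ i)))
...   | inj₁ l≤r = partner g (m + toℕ i)
                 , subst (m ≤_) (sym (left-partner g (m + toℕ i))) (m≤m+n m (toℕ i))
                 , l≤r , 𝒢-partner g (m + toℕ i)
...   | inj₂ r≤l = swap (partner g (m + toℕ i)) , m≤r , r≤l
                 , trans (𝒢-swap (partner g (m + toℕ i))) (𝒢-partner g (m + toℕ i))
mates-unbounded g m | no none = contradiction (+-cancelˡ-≡ m _ _ rows≡) (<⇒≢ i<j)
  where
  p : Fin (suc m) → Position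
  p i = partner g (m + toℕ i)
  r<m : ∀ i → right (p i) < m
  r<m i = ≰⇒> λ m≤r → none (i , m≤r)
  collision = pigeonhole (n<1+n m) (λ i → fromℕ< (r<m i))
  i = proj₁ collision
  j = proj₁ (proj₂ collision)
  i<j = proj₁ (proj₂ (proj₂ collision))
  p≡ : p i ≡ p j
  p≡ = column-injective (p i) (p j)
         (trans (sym (toℕ-fromℕ< (r<m i)))
           (trans (cong toℕ (proj₂ (proj₂ (proj₂ collision)))) (toℕ-fromℕ< (r<m j))))
         (trans (𝒢-partner g (m + toℕ i)) (sym (𝒢-partner g (m + toℕ j))))
  rows≡ : m + toℕ i ≡ m + toℕ j
  rows≡ = trans (sym (left-partner g (m + toℕ i)))
            (trans (cong left p≡) (left-partner g (m + toℕ j)))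

module Enumerate {P : ℕ → Set} (P? : ∀ n → Dec (P n))
                 (unbounded : ∀ m → ∃[ n ] m ≤ n × P n) where

  Next : ℕ → ℕ → Set
  Next m n = m ≤ n × P n × (∀ {k} → m ≤ k → P k → n ≤ k)

  search : ∀ fuel m n → m ≤ n → P n → n ≤ m + fuel → ∃ (Next m)
  search fuel m n m≤n Pn n≤ with P? m
  ... | yes Pm = m , ≤-refl , Pm , λ m≤k _ → m≤k
  search zero m n m≤n Pn n≤ | no ¬Pm =
    contradiction (subst P (≤-antisym (subst (n ≤_) (+-identityʳ m) n≤) m≤n) Pn) ¬Pm
  search (suc fuel) m n m≤n Pn n≤ | no ¬Pm
    with search fuel (suc m) n (skip m≤n Pn) Pn (subst (n ≤_) (+-suc m fuel) n≤)
    where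
    skip : ∀ {k} → m ≤ k → P k → m < k
    skip m≤k Pk = ≤∧≢⇒< m≤k λ { refl → ¬Pm Pk }
  ... | l , m<l , Pl , least =
    l , <⇒≤ m<l , Pl , λ m≤k Pk → least (≤∧≢⇒< m≤k λ { refl → ¬Pm Pk }) Pk

  next : ∀ m → ∃ (Next m)
  next m with unbounded m
  ... | n , m≤n , Pn = search n m n m≤n Pn (m≤n+m n m)

  enum : ℕ → ℕ
  enum zero    = proj₁ (next 0)
  enum (suc n) = proj₁ (next (suc (enum n)))

  enum-P : ∀ n → P (enum n)
  enum-P zero    = proj₁ (proj₂ (proj₂ (next 0)))
  enum-P (suc n) = proj₁ (proj₂ (proj₂ (next (suc (enum n)))))

  enum-step : ∀ n → enum n < enum (suc n)
  enum-step n = proj₁ (proj₂ (next (suc (enum n))))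

  enum-increasing : ∀ {i j} → i < j → enum i < enum j
  enum-increasing {i} {suc j} i<1+j with m<1+n⇒m<n∨m≡n i<1+j
  ... | inj₁ i<j  = <-trans (enum-increasing i<j) (enum-step j)
  ... | inj₂ refl = enum-step j

  enum-complete : ∀ {k} → P k → ∃[ n ] enum n ≡ k
  enum-complete {k} Pk =
    go k 0 (proj₂ (proj₂ (proj₂ (next 0))) z≤n Pk) (m≤n+m k (enum 0))
    where
    go : ∀ fuel n → enum n ≤ k → k ≤ enum n + fuel → ∃[ n ] enum n ≡ k
    go fuel n e≤k k≤ with enum n ≟ k
    ... | yes eq = n , eq
    go zero n e≤k k≤ | no ne =
      n , ≤-antisym e≤k (subst (k ≤_) (+-identityʳ (enum n)) k≤)
    go (suc fuel) n e≤k k≤ | no ne =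
      go fuel (suc n) (proj₂ (proj₂ (proj₂ (next (suc (enum n))))) (≤∧≢⇒< e≤k ne) Pk)
        (≤-trans (subst (k ≤_) (+-suc (enum n) fuel) k≤) (+-monoˡ-≤ fuel (enum-step n)))

-- Each row a contains exactly one position of value g (the partner of a),
-- and infinitely many of these satisfy left ≤ right, so quantifying over the
-- sequences s with IsGSequence g s is never vacuous.
gSequence-exists : ∀ g → ∃ (IsGSequence g)
gSequence-exists g = s , record
  { ordered    = λ n → subst (_≤ right (s n)) (sym (left-s n)) (enum-P n)
  ; value      = λ n → 𝒢-partner g (enum n)
  ; complete   = complete
  ; increasing = λ {i} {j} i<j →
      subst₂ _<_ (sym (left-s i)) (sym (left-s j)) (enum-increasing i<j)
  }
  where
  ≡partner : ∀ p → 𝒢 p ≡ g → p ≡ partner g (left p)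
  ≡partner p eq = row-injective p (partner g (left p))
    (sym (left-partner g (left p))) (trans eq (sym (𝒢-partner g (left p))))

  unbounded : ∀ m → ∃[ a ] m ≤ a × a ≤ right (partner g a)
  unbounded m with mates-unbounded g m
  ... | p , m≤l , l≤r , eq =
    left p , m≤l , subst (left p ≤_) (cong right (≡partner p eq)) l≤r

  open Enumerate (λ a → a ≤? right (partner g a)) unbounded

  s : ℕ → Position
  s n = partner g (enum n)

  left-s : ∀ n → left (s n) ≡ enum n
  left-s n = left-partner g (enum n)

  complete : ∀ p → left p ≤ right p → 𝒢 p ≡ g → ∃[ n ] s n ≡ p
  complete p l≤r eq
    with enum-complete {left p} (subst (left p ≤_) (cong right (≡partner p eq)) l≤r)
  ... | n , e≡ = n , trans (cong (partner g) e≡) (sym (≡partner p eq))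

-- The positions of value g are the graph of an involution a ↦ mate of a, built
-- greedily row by row.  A cell that row a skips holds a value below g, is the
-- hole, or lies in a column already used by an earlier row; counting these, no
-- mate is further than 2(g + 1) from its row.  Hence the displacements of the
-- mates for the values 0, …, g in a window of 2(g + 1) consecutive rows take
-- finitely many values and determine those of the next row, so they are
-- ultimately periodic in the row.  Restricting a periodic pattern of rows to
-- those with left ≤ right keeps it periodic.
module Submission where

open import Data.Fin.Base using (Fin; toℕ; fromℕ<; join; splitAt; finToFun; funToFin)
open import Data.Fin.Properties
  using (toℕ<n; toℕ-fromℕ<; fromℕ<-injective; pigeonhole; splitAt-join; finToFun-funToFin)
open import Data.Nat.Base
  using (ℕ; zero; suc; _+_; _∸_; _^_; _≤_; _<_; z≤n; s≤s; z<s; s≤s⁻¹)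
open import Data.Nat.Induction using (<-rec; <-wellFounded)
open import Data.Nat.Properties
open import Data.Nat.Tactic.RingSolver using (solve-∀)
open import Data.Product.Base using (∃-syntax; _×_; _,_; proj₁; proj₂)
open import Data.Sum.Base using (_⊎_; inj₁; inj₂)
open import Data.Sum.Properties using (inj₁-injective; inj₂-injective)
open import Induction.WellFounded using (Acc; acc)
open import Relation.Binary.Definitions using (tri<; tri≈; tri>)
open import Relation.Binary.PropositionalEquality
open import Relation.Nullary.Decidable using (Dec; yes; no)
open import Relation.Nullary.Negation using (¬_; contradiction)
open import Defs

-- Recurrence in finite-state sequences

least : ∀ {P : ℕ → Set} → (∀ n → Dec (P n)) → ∀ {n} → P n →
        ∃[ i ] P i × (∀ {j} → P j → i ≤ j)
least {P} P? Pn = go Pn (<-wellFounded _)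
  where
  go : ∀ {n} → P n → Acc _<_ n → ∃[ i ] P i × (∀ {j} → P j → i ≤ j)
  go {n} Pn (acc rs) with anyUpTo? P? n
  ... | yes (m , m<n , Pm) = go Pm (rs m<n)
  ... | no none            = n , Pn , λ Pj → ≮⇒≥ λ j<n → none (_ , j<n , Pj)

funToFin-injective : ∀ {m n} (f f′ : Fin m → Fin n) → funToFin f ≡ funToFin f′ →
                     ∀ i → f i ≡ f′ i
funToFin-injective f f′ eq i =
  trans (sym (finToFun-funToFin f i))
    (trans (cong (λ k → finToFun k i) eq) (finToFun-funToFin f′ i))

join-injective : ∀ m n (x y : Fin m ⊎ Fin n) → join m n x ≡ join m n y → x ≡ y
join-injective m n x y eq =
  trans (sym (splitAt-join m n x)) (trans (cong (splitAt m) eq) (splitAt-join m n y))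

-- If a window of W rows determines the next row, two equal windows stay equal
-- forever; finitely many window states force such a repetition.
window-recurrence :
  ∀ {K} W (x : ℕ → Fin K) (_≈_ : ℕ → ℕ → Set) →
  (∀ {m n} → x m ≡ x n → m ≈ n) →
  (∀ m n → (∀ {j} → j < W → (m + j) ≈ (n + j)) → (m + W) ≈ (n + W)) →
  ∃[ n₀ ] ∃[ p ] 1 ≤ p × (∀ n → n₀ ≤ n → n ≈ (n + p))
window-recurrence {K} W x _≈_ x≡⇒≈ step = m , p , 1≤p , recurs
  where
  window : ℕ → Fin W → Fin K
  window n j = x (n + toℕ j)
  -- There are `K ^ W` possible windows, so two of the first `K ^ W + 1` starting rows have the same
  -- one.
  collision = pigeonhole (n<1+n (K ^ W)) (λ i → funToFin (window (toℕ i)))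
  m = toℕ (proj₁ collision)
  n = toℕ (proj₁ (proj₂ collision))
  m<n : m < n
  m<n = proj₁ (proj₂ (proj₂ collision))
  p = n ∸ m
  1≤p : 1 ≤ p
  1≤p = m<n⇒0<n∸m m<n
  same-window : ∀ {j} → j < W → (m + j) ≈ (n + j)
  same-window {j} j<W = subst (λ j → (m + j) ≈ (n + j)) (toℕ-fromℕ< j<W)
    (x≡⇒≈ (funToFin-injective (window m) (window n)
      (proj₂ (proj₂ (proj₂ collision))) (fromℕ< j<W)))
  same : ∀ k → (m + k) ≈ (n + k)
  same = <-rec _ λ k rec → extend k rec
    where
    extend : ∀ k → (∀ {i} → i < k → (m + i) ≈ (n + i)) → (m + k) ≈ (n + k)
    extend k rec with k <? W
    ... | yes k<W = same-window k<W
    ... | no k≮W with m≤n⇒∃[o]m+o≡n (≮⇒≥ k≮W)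
    ...   | o , refl = subst₂ _≈_ (shift m W) (shift n W)
        (step (m + o) (n + o) λ {j} j<W →
          subst₂ _≈_ (sym (+-assoc m o j)) (sym (+-assoc n o j))
            (rec (subst (o + j <_) (+-comm o W) (+-monoʳ-< o j<W))))
      where
      shift : ∀ m W → m + o + W ≡ m + (W + o)
      shift m W = trans (+-assoc m o W) (cong (m +_) (+-comm o W))
  recurs : ∀ k → m ≤ k → k ≈ (k + p)
  recurs k m≤k with m≤n⇒∃[o]m+o≡n m≤k
  ... | o , refl = subst ((m + o) ≈_) n+o≡ (same o)
    where
    n+o≡ : n + o ≡ m + o + p
    n+o≡ = begin
      n + o         ≡⟨ cong (_+ o) (m+[n∸m]≡n (<⇒≤ m<n)) ⟨
      m + p + o     ≡⟨ +-assoc m p o ⟩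
      m + (p + o)   ≡⟨ cong (m +_) (+-comm p o) ⟩
      m + (o + p)   ≡⟨ +-assoc m o p ⟨
      m + o + p     ∎
      where open ≡-Reasoning

position-≡ : ∀ {p q} → left p ≡ left q → right p ≡ right q → p ≡ q
position-≡ refl refl = refl

-- The involution of mates

π : ℕ → ℕ → ℕ
π g a = right (partner g a)

right≡π : ∀ {g} p → 𝒢 p ≡ g → right p ≡ π g (left p)
right≡π {g} p eq = cong right (row-injective p (partner g (left p))
  (sym (left-partner g (left p))) (trans eq (sym (𝒢-partner g (left p)))))

π-at : ∀ {g a b} p → left p ≡ a → right p ≡ b → 𝒢 p ≡ g → π g a ≡ b
π-at p refl refl eq = sym (right≡π p eq)

-- `𝒢` is symmetric, so the swapped partner of `a` is the cell of value `g` in row `π g a`.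
π-involutive : ∀ g a → π g (π g a) ≡ a
π-involutive g a = π-at (swap (partner g a)) refl (left-partner g a)
  (trans (𝒢-swap (partner g a)) (𝒢-partner g a))

π-swap : ∀ {g a b} → π g a ≡ b → π g b ≡ a
π-swap {g} {a} refl = π-involutive g a

π-injective-value : ∀ {g h} a → π g a ≡ π h a → g ≡ h
π-injective-value {g} {h} a eq =
  trans (sym (𝒢-partner g a)) (trans
    (cong 𝒢 (position-≡ (trans (left-partner g a) (sym (left-partner h a))) eq))
    (𝒢-partner h a))

-- Bounded displacement of mates

skipped : ∀ {g a b} → b < π g a → Blocked g a b
skipped {g} {a} {b} b<π = blocked g a b λ { b′≤b (p , l , refl , eq) →
  <⇒≱ b<π (subst (_≤ b) (sym (π-at p l refl eq)) b′≤b) }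

-- The bound `a ≤ π g b` rules out `above`: the cell of value `g` in column `b` lies in row `π g b`.
-- What remains is the hole and the `g` values below `g`.
code<1+g : ∀ {g a b} (x : Blocked g a b) → a ≤ π g b → code x < suc g
code<1+g (hole _ _)           _   = z<s
code<1+g (small _ _ _ p<g)    _   = s≤s p<g
code<1+g (above q l<a r eq)   a≤π = contradiction
  (subst (_ ≤_) (π-swap (π-at q refl r eq)) a≤π) (<⇒≱ l<a)

rowCode : ∀ {g a b} → b < π g a → a ≤ π g b → Fin (suc g)
rowCode b<π a≤π = fromℕ< (code<1+g (skipped b<π) a≤π)

rowCode-injective : ∀ {g a b b′} (lt : b < π g a) (le : a ≤ π g b)
                    (lt′ : b′ < π g a) (le′ : a ≤ π g b′) →
                    rowCode lt le ≡ rowCode lt′ le′ → b ≡ b′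
rowCode-injective lt le lt′ le′ eq = code-injective (skipped lt) (skipped lt′)
  (fromℕ<-injective _ _ (code<1+g (skipped lt) le) (code<1+g (skipped lt′) le′) eq)

-- One batch of `suc g` codes for each of the two kinds of columns separated by `slot`.
width : ℕ → ℕ
width g = suc g + suc g

-- Among the columns skipped by row a, those with a mate in row ≥ a are told
-- apart by their codes in row a.  The others are used by rows below a; these
-- rows, seen as columns, are skipped by the first row i whose mate is ≥ a.
module _ (g a : ℕ) (a≤πa : a ≤ π g a) where
  private
    first : ∃[ i ] a ≤ π g i × (∀ {j} → a ≤ π g j → i ≤ j)
    first = least (λ i → a ≤? π g i) a≤πa
    i = proj₁ first
    a≤πi = proj₁ (proj₂ first)
    i≤ : ∀ {j} → a ≤ π g j → i ≤ j
    i≤ = proj₂ (proj₂ first)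

    -- Row `i` can thus encode column `π g c` with only `suc g` codes; minimality gives `i ≤ a ≤ c`.
    i≤ππ : ∀ {c} → a ≤ c → i ≤ π g (π g c)
    i≤ππ {c} a≤c = subst (i ≤_) (sym (π-involutive g c)) (≤-trans (i≤ a≤πa) a≤c)

  slot : ∀ c → a ≤ c → c < π g a → Fin (suc g) ⊎ Fin (suc g)
  slot c a≤c c<πa with a ≤? π g c
  ... | yes a≤πc = inj₁ (rowCode c<πa a≤πc)
  ... | no  a≰πc = inj₂ (rowCode (<-≤-trans (≰⇒> a≰πc) a≤πi) (i≤ππ a≤c))

  slot-injective : ∀ c c′ (l : a ≤ c) (u : c < π g a) (l′ : a ≤ c′) (u′ : c′ < π g a) →
                   slot c l u ≡ slot c′ l′ u′ → c ≡ c′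
  slot-injective c c′ l u l′ u′ eq with a ≤? π g c | a ≤? π g c′
  ... | yes r | yes r′ = rowCode-injective u r u′ r′ (inj₁-injective eq)
  ... | no  r | no  r′ = trans (sym (π-involutive g c)) (trans
    (cong (π g) (rowCode-injective (<-≤-trans (≰⇒> r) a≤πi) (i≤ππ l)
      (<-≤-trans (≰⇒> r′) a≤πi) (i≤ππ l′) (inj₂-injective eq)))
    (π-involutive g c′))
  ... | yes _ | no  _  = contradiction eq λ ()
  ... | no  _ | yes _  = contradiction eq λ ()

-- Opaque because with-abstraction would otherwise normalise the pigeonhole proof.
opaque
  π≤row+width : ∀ g a → π g a ≤ a + width g
  π≤row+width g a = ≮⇒≥ collide
    where
    -- Otherwise row `a` skips the `width g + 1` columns from `a` to `a + width g`, which share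
    -- `width g` slots.
    collide : ¬ (a + width g < π g a)
    collide far with pigeonhole (n<1+n (width g)) (λ i → join (suc g) (suc g) (slotAt i))
      where
      near : ∀ (i : Fin (suc (width g))) → a + toℕ i < π g a
      near i = ≤-<-trans (+-monoʳ-≤ a (s≤s⁻¹ (toℕ<n i))) far
      slotAt : Fin (suc (width g)) → Fin (suc g) ⊎ Fin (suc g)
      slotAt i = slot g a (≤-trans (m≤m+n a (width g)) (<⇒≤ far)) (a + toℕ i) (m≤m+n a _) (near i)
    ... | i , j , i<j , eq = <⇒≢ i<j (+-cancelˡ-≡ a _ _
      (slot-injective g a _ _ _ _ _ _ _ (join-injective (suc g) (suc g) _ _ eq)))

  row≤π+width : ∀ g a → a ≤ π g a + width g
  row≤π+width g a = subst (_≤ π g a + width g) (π-involutive g a) (π≤row+width g (π g a))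

-- A window of displacements determines the next row

-- π g a − a = π g b − b, without subtraction.
SameShift : ℕ → ℕ → ℕ → Set
SameShift g a b = a + π g b ≡ b + π g a

transport-shift : ∀ {g a b k} → SameShift g a b → π g a ≡ a + k → π g b ≡ b + k
transport-shift {g} {a} {b} {k} same eq = +-cancelˡ-≡ a _ _ (begin
  a + π g b     ≡⟨ same ⟩
  b + π g a     ≡⟨ cong (b +_) eq ⟩
  b + (a + k)   ≡⟨ swap-front b a k ⟩
  a + (b + k)   ∎)
  where
  open ≡-Reasoning
  swap-front : ∀ b a k → b + (a + k) ≡ a + (b + k)
  swap-front = solve-∀

module _ {g W : ℕ} (width≤W : width g ≤ W) where

  0<W : 0 < W
  0<W = <-≤-trans z<s width≤W

  SameWindow : ℕ → ℕ → Set
  SameWindow m n = ∀ {j} → j < W → SameShift g (m + j) (n + j)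

  -- A mate lies at most `width g` before its row, so a backward mate of row `m + W` is itself a row
  -- of the window.
  near-mate : ∀ {m b} → π g (m + W) ≡ b → b < m + W → ∃[ j ] j < W × b ≡ m + j
  near-mate {m} {b} eq b<m+W with m≤n⇒∃[o]m+o≡n m≤b
    where
    m≤b : m ≤ b
    m≤b = +-cancelʳ-≤ W m b (≤-trans (subst (λ b → m + W ≤ b + width g) eq (row≤π+width g (m + W)))
      (+-monoʳ-≤ b width≤W))
  ... | j , refl = j , +-cancelˡ-< m _ _ b<m+W , refl

  -- Row `m + j` reaches this column by the displacement `W ∸ j + k`, which row `n + j` shares.
  used-column : ∀ {m n j k} → SameWindow m n → j < W →
                π g (m + j) ≡ m + W + k → π g (n + j) ≡ n + W + k
  used-column {m} {n} {j} {k} window j<W eq = trans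
    (transport-shift {g} {m + j} {n + j} (window j<W) (trans eq (regroup m))) (sym (regroup n))
    where
    regroup : ∀ m → m + W + k ≡ m + j + (W ∸ j + k)
    regroup m = begin
      m + W + k               ≡⟨ cong (λ w → m + w + k) (m+[n∸m]≡n (<⇒≤ j<W)) ⟨
      m + (j + (W ∸ j)) + k   ≡⟨ assoc₄ m j (W ∸ j) k ⟩
      m + j + (W ∸ j + k)     ∎
      where
      open ≡-Reasoning
      assoc₄ : ∀ m j w k → m + (j + w) + k ≡ m + j + (w + k)
      assoc₄ = solve-∀

  -- By involution the window row `m + j` uses column `m + W`; then `n + j` uses column `n + W`, and
  -- the involution turns this back into the mate of `n + W`.
  next-backward : ∀ m n → SameWindow m n → π g (m + W) < m + W → SameShift g (m + W) (n + W)
  next-backward m n window lt with near-mate {m} refl lt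
  ... | j , j<W , eq = begin
    m + W + π g (n + W)   ≡⟨ cong (m + W +_) πn ⟩
    m + W + (n + j)       ≡⟨ exchange m W n j ⟩
    n + W + (m + j)       ≡⟨ cong (n + W +_) eq ⟨
    n + W + π g (m + W)   ∎
    where
    open ≡-Reasoning
    πn : π g (n + W) ≡ n + j
    πn = π-swap (trans
      (used-column {m} {n} {j} {0} window j<W (trans (π-swap eq) (sym (+-identityʳ (m + W)))))
      (+-identityʳ (n + W)))
    exchange : ∀ m W n j → m + W + (n + j) ≡ n + W + (m + j)
    exchange = solve-∀

  -- If `k < k′`, row `n + W` skips the column at distance `k`, and the reason carries over to row
  -- `m + W`: a smaller value, or an earlier row using the column, would then occupy the place of
  -- its mate of value `g`.
  no-overtaking : ∀ m n {k k′} → SameWindow n m →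
                  (∀ {h} → h < g → SameShift h (n + W) (m + W)) →
                  π g (m + W) ≡ m + W + k → π g (n + W) ≡ n + W + k′ → ¬ k < k′
  no-overtaking m n {k} window lower πm πn k<k′
    with skipped {g} {n + W} {n + W + k} (subst (n + W + k <_) (sym πn) (+-monoʳ-< (n + W) k<k′))
  ... | hole n+W≡0 _ = contradiction (m+n≡0⇒n≡0 n n+W≡0) (n>0⇒n≢0 0<W)
  ... | small p l r p<g = <⇒≢ p<g (π-injective-value (m + W)
    (trans (transport-shift {a = n + W} {m + W} (lower p<g) (π-at p l r refl)) (sym πm)))
  ... | above q l<n+W r eq
    with near-row
    where
    near-row : ∃[ j ] j < W × left q ≡ n + j
    near-row with m≤n⇒∃[o]m+o≡n n≤l
      where
      -- Mates reach at most `width g` forward, so a row using a column from `n + W` on cannot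
      -- precede the window.
      n≤l : n ≤ left q
      n≤l = +-cancelʳ-≤ W n (left q) (begin
        n + W                 ≤⟨ m≤m+n (n + W) k ⟩
        n + W + k             ≡⟨ r ⟨
        right q               ≡⟨ right≡π q eq ⟩
        π g (left q)          ≤⟨ π≤row+width g (left q) ⟩
        left q + width g      ≤⟨ +-monoʳ-≤ (left q) width≤W ⟩
        left q + W            ∎)
        where open ≤-Reasoning
    ... | j , n+j≡l =
      j , +-cancelˡ-< n _ _ (subst (_< n + W) (sym n+j≡l) l<n+W) , sym n+j≡l
  ...   | j , j<W , l≡ = <⇒≢ j<W (+-cancelˡ-≡ m _ _ (trans
    (sym (π-swap (used-column {n} {m} {j} {k} window j<W (π-at q l≡ r eq))))
    (π-swap πm)))

  -- A backward mate on either side settles both rows; two forward mates cannot overtake each other,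
  -- so their distances agree.
  next-shift : ∀ m n → SameWindow m n → (∀ {h} → h < g → SameShift h (m + W) (n + W)) →
               SameShift g (m + W) (n + W)
  next-shift m n window lower with π g (m + W) <? m + W | π g (n + W) <? n + W
  ... | yes lt | _      = next-backward m n window lt
  ... | no  _  | yes lt = sym (next-backward n m (λ j<W → sym (window j<W)) lt)
  ... | no  m≤ | no  n≤ with m≤n⇒∃[o]m+o≡n (≮⇒≥ m≤) | m≤n⇒∃[o]m+o≡n (≮⇒≥ n≤)
  ...   | k , eq | k′ , eq′ with <-cmp k k′
  ...     | tri< k<k′ _ _ = contradiction k<k′
    (no-overtaking m n (λ j<W → sym (window j<W)) (λ h<g → sym (lower h<g)) (sym eq) (sym eq′))
  ...     | tri> _ _ k′<k = contradiction k′<k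
    (no-overtaking n m window lower (sym eq′) (sym eq))
  ...     | tri≈ _ refl _ = begin
    m + W + π g (n + W)     ≡⟨ cong (m + W +_) eq′ ⟨
    m + W + (n + W + k)     ≡⟨ exchange (m + W) (n + W) k ⟩
    n + W + (m + W + k)     ≡⟨ cong (n + W +_) eq ⟩
    n + W + π g (m + W)     ∎
    where
    open ≡-Reasoning
    exchange : ∀ x y k → x + (y + k) ≡ y + (x + k)
    exchange = solve-∀

-- All values up to `g`, encoded by finitely many states

SameShifts : ℕ → ℕ → ℕ → Set
SameShifts g a b = ∀ {h} → h ≤ g → SameShift h a b

width-mono : ∀ {h g} → h ≤ g → width h ≤ width g
width-mono h≤g = +-mono-≤ (s≤s h≤g) (s≤s h≤g)

-- Strong induction on the value: within the new row, the mate of value `h` depends on those of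
-- smaller values.
next-shifts : ∀ g m n → (∀ {j} → j < width g → SameShifts g (m + j) (n + j)) →
              SameShifts g (m + width g) (n + width g)
next-shifts g m n window {h} = <-rec (λ h → h ≤ g → SameShift h (m + width g) (n + width g))
  (λ h rec h≤g → next-shift (width-mono h≤g) m n (λ j<W → window j<W h≤g)
    (λ l<h → rec l<h (≤-trans (<⇒≤ l<h) h≤g)))
  h

module _ (g : ℕ) where

  -- The displacement raised by `width g`, so that for `h ≤ g` the subtraction never truncates.
  offset : ℕ → ℕ → ℕ
  offset h a = (π h a + width g) ∸ a

  offset< : ∀ {h} → h ≤ g → ∀ a → offset h a < suc (width g + width g)
  offset< {h} h≤g a = s≤s (m≤n+o⇒m∸n≤o (π h a + width g) a (begin
    π h a + width g             ≤⟨ +-monoˡ-≤ (width g) (π≤row+width h a) ⟩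
    a + width h + width g       ≤⟨ +-monoˡ-≤ (width g) (+-monoʳ-≤ a (width-mono h≤g)) ⟩
    a + width g + width g       ≡⟨ +-assoc a (width g) (width g) ⟩
    a + (width g + width g)     ∎))
    where open ≤-Reasoning

  offset-≡⇒SameShift : ∀ {h} → h ≤ g → ∀ a b → offset h a ≡ offset h b → SameShift h a b
  offset-≡⇒SameShift {h} h≤g a b eq = +-cancelʳ-≡ (width g) _ _ (begin
    a + π h b + width g         ≡⟨ +-assoc a _ _ ⟩
    a + (π h b + width g)       ≡⟨ cong (a +_) (m+[n∸m]≡n (within b)) ⟨
    a + (b + offset h b)        ≡⟨ exchange a b (offset h b) ⟩
    b + (a + offset h b)        ≡⟨ cong (λ o → b + (a + o)) eq ⟨
    b + (a + offset h a)        ≡⟨ cong (b +_) (m+[n∸m]≡n (within a)) ⟩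
    b + (π h a + width g)       ≡⟨ +-assoc b _ _ ⟨
    b + π h a + width g         ∎)
    where
    open ≡-Reasoning
    within : ∀ a → a ≤ π h a + width g
    within a = ≤-trans (row≤π+width h a) (+-monoʳ-≤ (π h a) (width-mono h≤g))
    exchange : ∀ x y k → x + (y + k) ≡ y + (x + k)
    exchange = solve-∀

  offsets : ℕ → Fin (suc g) → Fin (suc (width g + width g))
  offsets a i = fromℕ< (offset< (s≤s⁻¹ (toℕ<n i)) a)

  offsets-≡⇒SameShifts : ∀ {a b} → funToFin (offsets a) ≡ funToFin (offsets b) → SameShifts g a b
  offsets-≡⇒SameShifts {a} {b} eq {h} h≤g =
    subst (λ h → SameShift h a b) (toℕ-fromℕ< (s≤s h≤g))
      (offset-≡⇒SameShift i≤g a b (fromℕ<-injective _ _ (offset< i≤g a) (offset< i≤g b)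
        (funToFin-injective (offsets a) (offsets b) eq i)))
    where
    i = fromℕ< (s≤s h≤g)
    i≤g = s≤s⁻¹ (toℕ<n i)

  shifts-recur : ∃[ n₀ ] ∃[ p ] 1 ≤ p × (∀ a → n₀ ≤ a → SameShift g a (a + p))
  shifts-recur with window-recurrence (width g) (λ a → funToFin (offsets a)) (SameShifts g)
                      offsets-≡⇒SameShifts (λ m n window → next-shifts g m n window)
  ... | n₀ , p , 1≤p , recurs = n₀ , p , 1≤p , λ a n₀≤a → recurs a n₀≤a ≤-refl

-- Increasing enumerations of a periodic set

module _ {e : ℕ → ℕ} (increasing : ∀ {i j} → i < j → e i < e j) where

  mono-≤ : ∀ {i j} → i ≤ j → e i ≤ e j
  mono-≤ {i} {j} i≤j with m≤n⇒m<n∨m≡n i≤j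
  ... | inj₁ i<j  = <⇒≤ (increasing i<j)
  ... | inj₂ refl = ≤-refl

  reflects-< : ∀ {i j} → e i < e j → i < j
  reflects-< ei<ej = ≰⇒> λ j≤i → <⇒≱ ei<ej (mono-≤ j≤i)

  n≤e : ∀ n → n ≤ e n
  n≤e zero    = z≤n
  n≤e (suc n) = ≤-<-trans (n≤e n) (increasing (n<1+n n))

  -- `up` and `down` make the range of `e` periodic with period `P` from `N` on; the index period
  -- `p` counts the terms in one such period.
  enumeration-shift : ∀ {N P} → 1 ≤ P →
    (∀ n → N ≤ e n → ∃[ r ] e r ≡ e n + P) →
    (∀ r y → N ≤ y → e r ≡ y + P → ∃[ n ] e n ≡ y) →
    ∃[ p ] 1 ≤ p × (∀ n → N ≤ n → e (n + p) ≡ e n + P)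
  -- Since `N ≤ e N`, the threshold on values serves for indices too; `p` is the distance from `N`
  -- to the index `q` of `e N + P`.
  enumeration-shift {N} {P} 1≤P up down with up N (n≤e N)
  ... | q , eq with m≤n⇒∃[o]m+o≡n N<q
    where
    N<q : N < q
    N<q = reflects-< (subst (e N <_) (sym eq) (m<m+n (e N) 1≤P))
  ...   | o , refl = suc o , z<s , shifted
    where
    next : ∀ n p → N ≤ n → e (n + p) ≡ e n + P → e (suc n + p) ≡ e (suc n) + P
    next n p N≤n IH = ≤-antisym
      -- `e (suc n) + P` is a term beyond `e (n + p)`, so the term following `e (n + p)` is at most
      -- that.
      (let r , er = up (suc n) (≤-trans N≤n (≤-trans (n≤1+n n) (n≤e (suc n))))
           n+p<r = reflects-< (subst₂ _<_ (sym IH) (sym er) (+-monoˡ-< P (increasing (n<1+n n))))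
       in subst (e (suc n + p) ≤_) er (mono-≤ n+p<r))
      -- Conversely, `e (suc n + p)` lowered by `P` is a term beyond `e n`, hence at least
      -- `e (suc n)`.
      (let en+P<e′ : e n + P < e (suc n + p)
           en+P<e′ = subst (_< e (suc n + p)) IH (increasing (n<1+n (n + p)))
           y+P≡ = m∸n+n≡m (≤-trans (m≤n+m P (e n)) (<⇒≤ en+P<e′))
           en<y = +-cancelʳ-< P _ _ (subst (e n + P <_) (sym y+P≡) en+P<e′)
           r , er = down (suc n + p) _ (≤-trans N≤n (≤-trans (n≤e n) (<⇒≤ en<y))) (sym y+P≡)
           n<r = reflects-< (subst (e n <_) (sym er) en<y)
       in subst (e (suc n) + P ≤_) y+P≡ (+-monoˡ-≤ P (subst (e (suc n) ≤_) er (mono-≤ n<r))))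

    shifted : ∀ n → N ≤ n → e (n + suc o) ≡ e n + P
    shifted n N≤n with m≤n⇒∃[o]m+o≡n N≤n
    ... | k , refl = go k
      where
      go : ∀ k → e (N + k + suc o) ≡ e (N + k) + P
      go zero    = subst (λ M → e (M + suc o) ≡ e M + P) (sym (+-identityʳ N))
                     (trans (cong e (+-suc N o)) eq)
      go (suc k) = subst (λ M → e (M + suc o) ≡ e M + P) (sym (+-suc N k))
                     (next (N + k) (suc o) (m≤m+n N k) (go k))

-- Periodicity along the `g`-sequence

SameShift-ordered : ∀ {g a b} → SameShift g a b → a ≤ π g a → b ≤ π g b
SameShift-ordered {g} {a} {b} same a≤π = +-cancelˡ-≤ a _ _ (begin
  a + b       ≡⟨ +-comm a b ⟩
  b + a       ≤⟨ +-monoʳ-≤ b a≤π ⟩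
  b + π g a   ≡⟨ same ⟨
  a + π g b   ∎)
  where open ≤-Reasoning

SameShift-difference : ∀ {g a b} → SameShift g a b → a ≤ π g a → π g b ∸ b ≡ π g a ∸ a
SameShift-difference {g} {a} {b} same a≤π = trans
  (cong (_∸ b) (transport-shift {g} {a} {b} same (sym (m+[n∸m]≡n a≤π))))
  (m+n∸m≡n b (π g a ∸ a))

theorem4 : ∀ (g : ℕ) (s : ℕ → Position) → IsGSequence g s →
    UltimatelyPeriodic (λ n → right (s n) ∸ left (s n))
theorem4 g s isG with shifts-recur g
... | N , P , 1≤P , recur = conclude (enumeration-shift increasing 1≤P up down)
  where
  open IsGSequence isG
  e : ℕ → ℕ
  e n = left (s n)

  right≡ : ∀ n → right (s n) ≡ π g (e n)
  right≡ n = right≡π (s n) (value n)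

  e≤π : ∀ n → e n ≤ π g (e n)
  e≤π n = subst (e n ≤_) (right≡ n) (ordered n)

  listed : ∀ a → a ≤ π g a → ∃[ n ] e n ≡ a
  listed a a≤π with complete (partner g a)
                     (subst (_≤ π g a) (sym (left-partner g a)) a≤π) (𝒢-partner g a)
  ... | n , eq = n , trans (cong left eq) (left-partner g a)

  -- The listed rows are those with `a ≤ π g a`, a condition that equal displacements preserve in
  -- both directions.
  up : ∀ n → N ≤ e n → ∃[ r ] e r ≡ e n + P
  up n N≤ = listed (e n + P) (SameShift-ordered (recur (e n) N≤) (e≤π n))

  down : ∀ r y → N ≤ y → e r ≡ y + P → ∃[ n ] e n ≡ y
  down r y N≤y eq = listed y (SameShift-ordered {g} {y + P} {y} (sym (recur y N≤y))
    (subst (λ a → a ≤ π g a) eq (e≤π r)))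

  conclude : ∃[ p ] 1 ≤ p × (∀ n → N ≤ n → e (n + p) ≡ e n + P) →
             UltimatelyPeriodic (λ n → right (s n) ∸ left (s n))
  conclude (p , 1≤p , shift) = N , p , 1≤p , λ n N≤n →
    let N≤e = ≤-trans N≤n (n≤e increasing n) in begin
    right (s (n + p)) ∸ e (n + p)         ≡⟨ cong (_∸ e (n + p)) (right≡ (n + p)) ⟩
    π g (e (n + p)) ∸ e (n + p)           ≡⟨ cong (λ a → π g a ∸ a) (shift n N≤n) ⟩
    π g (e n + P) ∸ (e n + P)             ≡⟨ SameShift-difference (recur (e n) N≤e) (e≤π n) ⟩
    π g (e n) ∸ e n                       ≡⟨ cong (_∸ e n) (right≡ n) ⟨
    right (s n) ∸ e n                     ∎
    where open ≡-Reasoning
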